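{- Let $n\in\mathbb{N}$, $n\ge 1$. For every Hamiltonian digraph $G_\Gamma\in\mathcal{G}(n)$ there exists a unate Boolean network $g:\{0,1\}^n\to\{0,1\}^n$ whose dynamics $\Gamma(g)$ is isomorphic to $G_\Gamma$.
   Context: A Boolean network with $n$ variables is a map $f=(f_1,\dots,f_n):\{0,1\}^n\to\{0,1\}^n$; write $[n]=\{1,\dots,n\}$. Its dynamics is the digraph $\Gamma(f)$ with vertex set $\{0,1\}^n$ and arcs $(x,f(x))$, $x\in\{0,1\}^n$. $\mathcal{G}(n)$ is the family of digraphs (loops allowed) with exactly $2^n$ vertices in which every vertex has out-degree one. A trajectory is a path (directed walk along arcs) that does not repeat arcs. A Boolean network $f$ is Hamiltonian if $\Gamma(f)$ has a trajectory that visits all configurations (hence it has a unique attractor, which is a fixed point or a cycle of length $k\in\{2,\dots,2^n\}$). A digraph $G_\Gamma\in\mathcal{G}(n)$ is Hamiltonian if $G_\Gamma\cong\Gamma(f)$ for some Hamiltonian Boolean network $f$, i.e. if it has a trajectory visiting all its vertices. Let $e_i$ be the $i$-th unit vector and $\oplus$ componentwise addition modulo 2. The function $f_j$ is increasing (resp. decreasing) in component $i$ if $f_j(x)\le f_j(x\oplus e_i)$ (resp. $f_j(x)\ge f_j(x\oplus e_i)$) for every $x$ with $x_i=0$. $f_j$ is unate if for each $i\in[n]$ it is increasing or decreasing in component $i$; the network is unate if all $f_j$ are unate. -}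

module Defs where

open import Data.Bool using (Bool; true; false; _xor_)
import Data.Bool as Bool
open import Data.Fin using (Fin)
open import Data.List using (List; []; _∷_)
open import Data.List.Membership.Propositional using (_∈_)
open import Data.List.Relation.Unary.Unique.Propositional using (Unique)
open import Data.Nat using (ℕ; _^_)
open import Data.Product using (Σ; ∃!; ∃₂; _×_; _,_)
open import Data.Sum using (_⊎_)
open import Data.Vec using (Vec; lookup; replicate; zipWith; _[_]≔_)
open import Function.Bundles using (_↔_; _⇔_; Inverse)
open import Level using (0ℓ)
open import Relation.Binary.Core using (Rel)
open import Relation.Binary.Construct.Closure.ReflexiveTransitive
  using (Star; ε; _◅_)
open import Relation.Binary.PropositionalEquality using (_≡_)

-- There are no parallel arcs: only whether x ⟶ y is inhabited matters, and
-- an arc is identified with the pair of its endpoints.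

record Digraph : Set₁ where
  field
    Vertex : Set
    _⟶_    : Rel Vertex 0ℓ

open Digraph public using (Vertex)

Arc : (G : Digraph) → Rel (Vertex G) 0ℓ
Arc = Digraph._⟶_

infix 4 _≅_

_≅_ : Digraph → Digraph → Set
G ≅ H = Σ (Vertex G ↔ Vertex H) λ φ →
  ∀ x y → Arc G x y ⇔ Arc H (Inverse.to φ x) (Inverse.to φ y)

record _∈𝒢_ (G : Digraph) (n : ℕ) : Set where
  field
    order       : Vertex G ↔ Fin (2 ^ n)
    outdegree≡1 : ∀ x → ∃! _≡_ (Arc G x)

Path : (G : Digraph) → Rel (Vertex G) 0ℓ
Path G = Star (Arc G)

vertices : ∀ {G x y} → Path G x y → List (Vertex G)
vertices {x = x} ε       = x ∷ []
vertices {x = x} (_ ◅ p) = x ∷ vertices p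

arcs : ∀ {G x y} → Path G x y → List (Vertex G × Vertex G)
arcs ε                         = []
arcs (_◅_ {i = x} {j = y} _ p) = (x , y) ∷ arcs p

IsTrajectory : ∀ {G x y} → Path G x y → Set
IsTrajectory p = Unique (arcs p)

VisitsAll : ∀ {G x y} → Path G x y → Set
VisitsAll p = ∀ v → v ∈ vertices p

Config : ℕ → Set
Config n = Vec Bool n

BooleanNetwork : ℕ → Set
BooleanNetwork n = Config n → Config n

component : ∀ {n} → BooleanNetwork n → Fin n → Config n → Bool
component f j x = lookup (f x) j

Γ : ∀ {n} → BooleanNetwork n → Digraph
Γ {n} f = record { Vertex = Config n ; _⟶_ = λ x y → f x ≡ y }

HamiltonianNetwork : ∀ {n} → BooleanNetwork n → Set
HamiltonianNetwork f =
  ∃₂ λ x y → Σ (Path (Γ f) x y) λ p → IsTrajectory p × VisitsAll p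

HamiltonianDigraph : ℕ → Digraph → Set
HamiltonianDigraph n G =
  Σ (BooleanNetwork n) λ f → HamiltonianNetwork f × G ≅ Γ f

infixl 6 _⊕_

_⊕_ : ∀ {n} → Config n → Config n → Config n
_⊕_ = zipWith _xor_

e : ∀ {n} → Fin n → Config n
e {n} i = replicate n false [ i ]≔ true

IncreasingIn : ∀ {n} → (Config n → Bool) → Fin n → Set
IncreasingIn h i = ∀ x → lookup x i ≡ false → h x Bool.≤ h (x ⊕ e i)

DecreasingIn : ∀ {n} → (Config n → Bool) → Fin n → Set
DecreasingIn h i = ∀ x → lookup x i ≡ false → h (x ⊕ e i) Bool.≤ h x

Unate : ∀ {n} → (Config n → Bool) → Set
Unate h = ∀ i → IncreasingIn h i ⊎ DecreasingIn h i

UnateNetwork : ∀ {n} → BooleanNetwork n → Set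
UnateNetwork f = ∀ j → Unate (component f j)

{-# OPTIONS --safe #-}
-- Call h : {0,1}ⁿ → {0,1} free at a configuration a if every redefinition of h
-- at a is monotone in each variable, in a direction that does not depend on the
-- new value. It suffices to find, for every n ≥ 1, a network F whose
-- dynamics is a cycle of length 2ⁿ and all of whose components are free at 0:
-- redirecting the arc out of 0 then yields every Hamiltonian digraph.
-- Such an F which moreover commutes with complementation is built by induction
-- on n. Take the copies {0} × F and {1} × F of the cycle and exchange the
-- images of the antipodal points (0,0) and (1,1…1), which joins both into one
-- cycle. A component of F takes opposite values at 0 and at 1…1, so exchanging
-- them only creates dependence on the new variable, in a single direction;
-- the remaining directions are unaffected since F is free at 0, and by symmetry
-- also at 1…1.
module Submission where

open import Defs
open import Data.Bool using (Bool; true; false; not; _xor_; if_then_else_)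
import Data.Bool as Bool
import Data.Bool.Properties as Boolₚ
open import Data.Fin using (Fin; zero; suc; toℕ; fromℕ<)
open import Data.Fin.Properties
  using (pigeonhole; injective⇒≤; toℕ<n; toℕ-fromℕ<; toℕ-injective; fromℕ<-injective)
open import Data.List.Membership.Propositional using (_∈_)
open import Data.List.Relation.Unary.Any using (here; there)
open import Data.Nat using (ℕ; zero; suc; _≤_; _<_; _<?_; _+_; z≤n; s≤s⁻¹)
open import Data.Nat.GeneralisedArithmetic using (fold; fold-+)
open import Data.Nat.Properties
  using (≤-trans; ≤-antisym; ≮⇒≥; <⇒≱; ≤-<-trans; n<1+n; suc-injective; <-cmp)
open import Data.Product using (Σ; ∃; _×_; _,_; proj₁; proj₂)
open import Data.Sum using (_⊎_; inj₁; inj₂)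
import Data.Sum as Sum
open import Data.Vec using ([]; _∷_; lookup; replicate; map)
open import Data.Vec.Properties
  using (≡-dec; lookup-map; lookup-replicate; lookup-zipWith; lookup∘update; map-replicate;
         zipWith-identityʳ; map-∘; map-cong; map-id; ∷-injectiveʳ)
open import Function using (_∘_; flip; _↔_; mk⇔; mk↔ₛ′; Inverse; Equivalence)
open import Function.Construct.Composition using (_↔-∘_)
open import Function.Construct.Symmetry using (↔-sym)
open import Level using (0ℓ)
open import Relation.Binary.Core using (Rel)
open import Relation.Binary.Construct.Closure.ReflexiveTransitive using (ε; _◅_)
open import Relation.Binary.Definitions using (tri<; tri≈; tri>)
open import Relation.Binary.PropositionalEquality
  using (_≡_; _≢_; _≗_; refl; sym; trans; cong; subst; subst₂; module ≡-Reasoning)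
open import Relation.Nullary using (Dec; yes; no; contradiction; ⌊_⌋)

private variable
  A B : Set
  n N : ℕ

-- Orbits

Reachable : (A → A) → Rel A 0ℓ
Reachable f x y = ∃ λ k → fold x f k ≡ y

module _ {f : A → A} where

  reachable-refl : ∀ {x} → Reachable f x x
  reachable-refl = 0 , refl

  reachable-step : ∀ x → Reachable f x (f x)
  reachable-step x = 1 , refl

  reachable-trans : ∀ {x y z} → Reachable f x y → Reachable f y z → Reachable f x z
  reachable-trans {x} (k , refl) (l , refl) = l + k , fold-+ x f l

  reachable-preserves : ∀ {x y} (P : A → Set) → (∀ z → P z → P (f z)) →
                        P x → Reachable f x y → P y
  reachable-preserves P step px (zero , refl) = px
  reachable-preserves P step px (suc k , refl) =
    step _ (reachable-preserves P step px (k , refl))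

  -- A walk about to reach position `j` can continue from position `i` instead, so it never has to
  -- leave the positions below `j`.
  repetition⇒bounded : ∀ {x i j} → i < j → fold x f i ≡ fold x f j →
                       ∀ k → ∃ λ l → l < j × fold x f l ≡ fold x f k
  repetition⇒bounded i<j eq zero = 0 , ≤-<-trans z≤n i<j , refl
  repetition⇒bounded {x} {i} {j} i<j eq (suc k)
    with l , l<j , eq′ ← repetition⇒bounded i<j eq k
    with suc l <? j
  ... | yes 1+l<j = suc l , 1+l<j , cong f eq′
  ... | no  1+l≮j = i , i<j , (begin
    fold x f i       ≡⟨ eq ⟩
    fold x f j       ≡⟨ cong (fold x f) (≤-antisym (≮⇒≥ 1+l≮j) l<j) ⟩
    f (fold x f l)   ≡⟨ cong f eq′ ⟩
    f (fold x f k)   ∎)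
    where open ≡-Reasoning

module _ {f : A → A} {x : A} (φ : A ↔ Fin N) (all : ∀ y → Reachable f x y) where

  private module φ = Inverse φ

  φ-injective : ∀ {y z} → φ.to y ≡ φ.to z → y ≡ z
  φ-injective {y} {z} eq = trans (sym (φ.strictlyInverseʳ y)) (φ.inverseʳ eq)

  -- A repetition at `j` leaves at most `j` points in the orbit, but the orbit is all of `A`.
  repetition⇒≥ : ∀ {i j} → i < j → fold x f i ≡ fold x f j → N ≤ j
  repetition⇒≥ {i} {j} i<j eq = injective⇒≤ {f = index} index-injective
    where
    bounded : ∀ y → ∃ λ l → l < j × fold x f l ≡ y
    bounded y with k , refl ← all y = repetition⇒bounded i<j eq k

    index : Fin N → Fin j
    index p = fromℕ< (proj₁ (proj₂ (bounded (φ.from p))))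

    index-injective : ∀ {p q} → index p ≡ index q → p ≡ q
    index-injective {p} {q} eq′ = begin
      p                 ≡⟨ φ.strictlyInverseˡ p ⟨
      φ.to (φ.from p)   ≡⟨ cong φ.to from≡ ⟩
      φ.to (φ.from q)   ≡⟨ φ.strictlyInverseˡ q ⟩
      q                 ∎
      where
      open ≡-Reasoning
      from≡ : φ.from p ≡ φ.from q
      from≡ with l , l<j , e₁ ← bounded (φ.from p) | m , m<j , e₂ ← bounded (φ.from q) =
        trans (sym e₁) (trans (cong (fold x f) (fromℕ<-injective l m l<j m<j eq′)) e₂)

  orbit-injective : ∀ {i j} → i < N → j < N → fold x f i ≡ fold x f j → i ≡ j
  orbit-injective {i} {j} i<N j<N eq with <-cmp i j
  ... | tri< i<j _ _ = contradiction (repetition⇒≥ i<j eq) (<⇒≱ j<N)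
  ... | tri≈ _ i≡j _ = i≡j
  ... | tri> _ _ j<i = contradiction (repetition⇒≥ j<i (sym eq)) (<⇒≱ i<N)

  orbit-surjective : ∀ y → ∃ λ k → k < N × fold x f k ≡ y
  orbit-surjective y
    -- Pigeonhole on the positions 0 to `N` gives a repetition with `j` at most `N`.
    with i , j , i<j , eq ← pigeonhole (n<1+n N) (λ k → φ.to (fold x f (toℕ k)))
       | k , refl ← all y
    with l , l<j , eq′ ← repetition⇒bounded i<j (φ-injective eq) k
    = l , ≤-trans l<j (s≤s⁻¹ (toℕ<n j)) , eq′

  -- The orbit may be a tail leading into a cycle: only its first `N` positions have to be distinct.
  orbit↔ : Fin N ↔ A
  orbit↔ = mk↔ₛ′ (fold x f ∘ toℕ) index to∘index
    (λ k → toℕ-injective (orbit-injective (toℕ<n (index _)) (toℕ<n k) (to∘index _)))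
    where
    index : A → Fin N
    index y = fromℕ< (proj₁ (proj₂ (orbit-surjective y)))

    to∘index : ∀ y → fold x f (toℕ (index y)) ≡ y
    to∘index y with k , k<N , eq ← orbit-surjective y =
      trans (cong (fold x f) (toℕ-fromℕ< k<N)) eq

vertices⇒reachable : ∀ {f : BooleanNetwork n} {x y v} (p : Path (Γ f) x y) →
                     v ∈ vertices p → Reachable f x v
vertices⇒reachable ε          (here refl) = reachable-refl
vertices⇒reachable (_ ◅ p)    (here refl) = reachable-refl
vertices⇒reachable (refl ◅ p) (there v∈p) =
  reachable-trans (reachable-step _) (vertices⇒reachable p v∈p)

-- Functions changed at one configuration

_≟_ : (x y : Config n) → Dec (x ≡ y)
_≟_ = ≡-dec Bool._≟_

-- Opaque, so that h, a, c and x can be inferred from update h a c x.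
opaque

  update : (Config n → A) → Config n → A → Config n → A
  update h a c x = if ⌊ x ≟ a ⌋ then c else h x

  update-≡ : ∀ (h : Config n → A) {a c x} → x ≡ a → update h a c x ≡ c
  update-≡ h {a} {x = x} x≡a with x ≟ a
  ... | yes _   = refl
  ... | no  x≢a = contradiction x≡a x≢a

  update-≢ : ∀ (h : Config n → A) {a c x} → x ≢ a → update h a c x ≡ h x
  update-≢ h {a} {x = x} x≢a with x ≟ a
  ... | yes x≡a = contradiction x≡a x≢a
  ... | no  _   = refl

  update-∘ : ∀ (t : A → B) (h : Config n → A) a c →
             t ∘ update h a c ≗ update (t ∘ h) a (t c)
  update-∘ t h a c x with x ≟ a
  ... | yes _ = refl
  ... | no  _ = refl

-- Redirecting the arc out of one configuration

≅-sym : ∀ {G H} → G ≅ H → H ≅ G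
≅-sym {G} {H} (φ , φ-arc) = ↔-sym φ , λ x y →
  let arc = φ-arc (from x) (from y) in
  mk⇔ (Equivalence.from arc ∘
         subst₂ (Arc H) (sym (strictlyInverseˡ x)) (sym (strictlyInverseˡ y)))
      (subst₂ (Arc H) (strictlyInverseˡ x) (strictlyInverseˡ y) ∘ Equivalence.to arc)
  where open Inverse φ

≅-trans : ∀ {G H K} → G ≅ H → H ≅ K → G ≅ K
≅-trans (φ , φ-arc) (ψ , ψ-arc) = (ψ ↔-∘ φ) , λ x y →
  mk⇔ (Equivalence.to (ψ-arc _ _) ∘ Equivalence.to (φ-arc x y))
      (Equivalence.from (φ-arc x y) ∘ Equivalence.from (ψ-arc _ _))

conjugate⇒≅ : (f g : BooleanNetwork n) (ψ : Config n ↔ Config n) →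
              (∀ x → g (Inverse.to ψ x) ≡ Inverse.to ψ (f x)) → Γ f ≅ Γ g
conjugate⇒≅ f g ψ conj = ψ , λ x y →
  mk⇔ (λ { refl → conj x })
      (λ eq → trans (sym (inverseʳ (trans (sym eq) (conj x)))) (strictlyInverseʳ y))
  where open Inverse ψ

-- Matching the k-th points of both orbits is compatible with the dynamics
-- except at the last point of the orbit of F z, which is z itself.
redirect : {f F : BooleanNetwork n} {x z : Config n} → Config n ↔ Fin N →
           (∀ y → Reachable f x y) → (∀ y → Reachable F (F z) y) →
           ∃ λ c → Γ f ≅ Γ (update F z c)
redirect {N = N} {f = f} {F} {x} {z} φ f-all F-all =
  -- This value is forced by conjugation at `z`: it is the image under `ψ` of the `f`-successor of
  -- the last point in the orbit of `f`.
  ψ.to (f (ψ.from z)) , conjugate⇒≅ f (update F z _) ψ conj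
  where
  orbit-f = orbit↔ φ f-all
  orbit-F = orbit↔ φ F-all
  ψ = orbit-F ↔-∘ ↔-sym orbit-f
  module f = Inverse orbit-f
  module F = Inverse orbit-F
  module ψ = Inverse ψ

  open ≡-Reasoning

  last : ∀ k → F.to k ≡ z → suc (toℕ k) ≡ N
  last k eq with suc (toℕ k) <? N
  ... | no  1+k≮N = ≤-antisym (toℕ<n k) (≮⇒≥ 1+k≮N)
  -- The next position would hold `F z` again, which already sits at position 0.
  ... | yes 1+k<N with () ← orbit-injective φ F-all 1+k<N (≤-<-trans z≤n 1+k<N) (cong F eq)

  not-last : ∀ k → F.to k ≢ z → suc (toℕ k) < N
  not-last k k≢z with suc (toℕ k) <? N
  ... | yes 1+k<N = 1+k<N
  ... | no  1+k≮N = contradiction (trans (cong F.to k≡l) (F.strictlyInverseˡ z)) k≢z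
    where
    k≡l : k ≡ F.from z
    k≡l = toℕ-injective (suc-injective
      (trans (≤-antisym (toℕ<n k) (≮⇒≥ 1+k≮N)) (sym (last _ (F.strictlyInverseˡ z)))))

  shift : ∀ k → F.to k ≢ z → F (F.to k) ≡ ψ.to (f (f.to k))
  shift k k≢z = begin
    F (F.to k)              ≡⟨ cong (fold (F z) F) (toℕ-fromℕ< 1+k<N) ⟨
    F.to k⁺                 ≡⟨ cong F.to (f.strictlyInverseʳ k⁺) ⟨
    ψ.to (f.to k⁺)          ≡⟨ cong (ψ.to ∘ fold x f) (toℕ-fromℕ< 1+k<N) ⟩
    ψ.to (f (f.to k))       ∎
    where
    1+k<N = not-last k k≢z
    k⁺ = fromℕ< 1+k<N

  conj : ∀ y → update F z (ψ.to (f (ψ.from z))) (ψ.to y) ≡ ψ.to (f y)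
  conj y with ψ.to y ≟ z
  ... | yes ψy≡z = trans (update-≡ F ψy≡z) (cong (ψ.to ∘ f) (ψ.inverseʳ (sym ψy≡z)))
  ... | no  ψy≢z = begin
    update F z _ (ψ.to y)      ≡⟨ update-≢ F ψy≢z ⟩
    F (ψ.to y)                 ≡⟨ shift (f.from y) ψy≢z ⟩
    ψ.to (f (f.to (f.from y))) ≡⟨ cong (ψ.to ∘ f) (f.strictlyInverseˡ y) ⟩
    ψ.to (f y)                 ∎

-- Complementation

∁ : Config n → Config n
∁ = map not

zeros ones : Config n
zeros = replicate _ false
ones  = replicate _ true

∁-involutive : (x : Config n) → ∁ (∁ x) ≡ x
∁-involutive x = begin
  ∁ (∁ x)             ≡⟨ map-∘ not not x ⟨
  map (not ∘ not) x   ≡⟨ map-cong Boolₚ.not-involutive x ⟩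
  map (λ b → b) x     ≡⟨ map-id x ⟩
  x                   ∎
  where open ≡-Reasoning

∁-swap : {x y : Config n} → ∁ x ≡ y → x ≡ ∁ y
∁-swap {x = x} refl = sym (∁-involutive x)

∁-zeros : ∁ (zeros {n}) ≡ ones
∁-zeros = map-replicate not false _

∁-ones : ∁ (ones {n}) ≡ zeros
∁-ones = map-replicate not true _

∁-⊕-⊕ : (x y : Config n) → ∁ (x ⊕ y) ⊕ y ≡ ∁ x
∁-⊕-⊕ []          []          = refl
∁-⊕-⊕ (true  ∷ x) (true  ∷ y) = cong (_ ∷_) (∁-⊕-⊕ x y)
∁-⊕-⊕ (true  ∷ x) (false ∷ y) = cong (_ ∷_) (∁-⊕-⊕ x y)
∁-⊕-⊕ (false ∷ x) (true  ∷ y) = cong (_ ∷_) (∁-⊕-⊕ x y)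
∁-⊕-⊕ (false ∷ x) (false ∷ y) = cong (_ ∷_) (∁-⊕-⊕ x y)

lookup-⊕-e : ∀ (x : Config n) i → lookup (x ⊕ e i) i ≡ not (lookup x i)
lookup-⊕-e x i = begin
  lookup (x ⊕ e i) i               ≡⟨ lookup-zipWith _xor_ i x (e i) ⟩
  lookup x i xor lookup (e i) i    ≡⟨ cong (lookup x i xor_) (lookup∘update i zeros true) ⟩
  lookup x i xor true              ≡⟨ Boolₚ.xor-comm (lookup x i) true ⟩
  not (lookup x i)                 ∎
  where open ≡-Reasoning

∁x≢zeros : {x : Config n} → x ≢ ones → ∁ x ≢ zeros
∁x≢zeros x≢1 eq = x≢1 (trans (∁-swap eq) ∁-zeros)

∁x≢ones : {x : Config n} → x ≢ zeros → ∁ x ≢ ones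
∁x≢ones x≢0 eq = x≢0 (trans (∁-swap eq) ∁-ones)

SelfDual : BooleanNetwork n → Set
SelfDual F = ∀ x → F (∁ x) ≡ ∁ (F x)

reachable-∁ : ∀ {F : BooleanNetwork n} → SelfDual F → ∀ {x y} →
              Reachable F x y → Reachable F (∁ x) (∁ y)
reachable-∁ {F = F} dual {x} = reachable-preserves (Reachable F (∁ x) ∘ ∁)
  (λ z r → reachable-trans r (1 , dual z)) reachable-refl

-- Monotonicity

-- Both directions are instances: IncreasingIn is Along Bool._≤_, and
-- DecreasingIn is Along (flip Bool._≤_).
Along : Rel Bool 0ℓ → (Config n → Bool) → Fin n → Set
Along _≲_ h i = ∀ x → lookup x i ≡ false → h x ≲ h (x ⊕ e i)

≡false⇒≤ : ∀ {x y} → x ≡ false → x Bool.≤ y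
≡false⇒≤ refl = Boolₚ.≤-minimum _

≡true⇒≤ : ∀ {x y} → y ≡ true → x Bool.≤ y
≡true⇒≤ refl = Boolₚ.≤-maximum _

not-antitone : ∀ {x y} → x Bool.≤ y → not y Bool.≤ not x
not-antitone Bool.f≤t = Bool.f≤t
not-antitone Bool.b≤b = Bool.b≤b

module _ (_≲_ : Rel Bool 0ℓ) where

  along-resp-≗ : ∀ {h k : Config n → Bool} {i} → h ≗ k → Along _≲_ h i → Along _≲_ k i
  along-resp-≗ h≗k mono x xᵢ = subst₂ _≲_ (h≗k x) (h≗k _) (mono x xᵢ)

  -- Complementing the argument turns each edge in direction `i` upside down, and negating the value
  -- reverses the order back.
  along-∁ : (∀ {x y} → x ≲ y → not y ≲ not x) →
            ∀ {h : Config n → Bool} {i} → Along _≲_ h i → Along _≲_ (not ∘ h ∘ ∁) i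
  along-∁ anti {h} {i} mono x xᵢ =
    anti (subst (λ y → h (∁ (x ⊕ e i)) ≲ h y) (∁-⊕-⊕ x (e i))
      (mono (∁ (x ⊕ e i)) lookup≡false))
    where
    lookup≡false : lookup (∁ (x ⊕ e i)) i ≡ false
    lookup≡false rewrite lookup-map i not (x ⊕ e i) | lookup-⊕-e x i | xᵢ = refl

  along-zero : {h : Config (suc n) → Bool} →
               (∀ x → h (false ∷ x) ≲ h (true ∷ x)) → Along _≲_ h zero
  along-zero {h = h} le (false ∷ x) refl =
    subst (λ y → h (false ∷ x) ≲ h (true ∷ y))
      (sym (zipWith-identityʳ Boolₚ.xor-identityʳ x)) (le x)

  along-suc : {h : Config (suc n) → Bool} {i : Fin n} →
              Along _≲_ (h ∘ (false ∷_)) i → Along _≲_ (h ∘ (true ∷_)) i →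
              Along _≲_ h (suc i)
  along-suc mono₀ mono₁ (false ∷ x) = mono₀ x
  along-suc mono₀ mono₁ (true  ∷ x) = mono₁ x

-- Monotonicity under redefinition at one configuration

FreeAlong : Rel Bool 0ℓ → (Config n → Bool) → Config n → Fin n → Set
FreeAlong _≲_ h a i = ∀ c → Along _≲_ (update h a c) i

Free : (Config n → Bool) → Config n → Set
Free h a = ∀ i → FreeAlong Bool._≤_ h a i ⊎ FreeAlong (flip Bool._≤_) h a i

lookup-true⇒≢zeros : ∀ (x : Config n) i → lookup x i ≡ true → x ≢ zeros
lookup-true⇒≢zeros x i xᵢ refl with () ← trans (sym xᵢ) (lookup-replicate i false)

lookup-false⇒≢ones : ∀ (x : Config n) i → lookup x i ≡ false → x ≢ ones
lookup-false⇒≢ones x i xᵢ refl with () ← trans (sym xᵢ) (lookup-replicate i true)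

-- The upper end of an edge has a coordinate `true`, so it differs from `zeros` and keeps the value
-- `false`.
update-false-decreasing : ∀ c (i : Fin n) → DecreasingIn (update (λ _ → false) zeros c) i
update-false-decreasing c i x xᵢ =
  ≡false⇒≤ (update-≢ _ (lookup-true⇒≢zeros (x ⊕ e i) i
      (trans (lookup-⊕-e x i) (cong not xᵢ))))

-- Dually, the lower end of an edge is never `ones` and keeps the value `true`.
update-true-decreasing : ∀ c (i : Fin n) → DecreasingIn (update (λ _ → true) ones c) i
update-true-decreasing c i x xᵢ =
  ≡true⇒≤ (update-≢ _ (lookup-false⇒≢ones x i xᵢ))

-- By self-duality, redefining `h` at `ones` as `c` is conjugate under complementation to redefining
-- it at `zeros` as `not c`, and this conjugation preserves directions.
freeAlong-ones : (_≲_ : Rel Bool 0ℓ) → (∀ {x y} → x ≲ y → not y ≲ not x) →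
                 {h : Config n → Bool} {i : Fin n} → (∀ x → h (∁ x) ≡ not (h x)) →
                 FreeAlong _≲_ h zeros i → FreeAlong _≲_ h ones i
freeAlong-ones _≲_ anti {h} dual mono c =
  along-resp-≗ _≲_ agree (along-∁ _≲_ anti (mono (not c)))
  where
  open ≡-Reasoning
  agree : not ∘ update h zeros (not c) ∘ ∁ ≗ update h ones c
  agree x with x ≟ ones
  ... | yes refl = begin
    not (update h zeros (not c) (∁ ones))   ≡⟨ cong not (update-≡ h ∁-ones) ⟩
    not (not c)                             ≡⟨ Boolₚ.not-involutive c ⟩
    c                                       ≡⟨ update-≡ h refl ⟨
    update h ones c ones                    ∎
  ... | no  x≢1  = begin
    not (update h zeros (not c) (∁ x))   ≡⟨ cong not (update-≢ h (∁x≢zeros x≢1)) ⟩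
    not (h (∁ x))                        ≡⟨ cong not (dual x) ⟩
    not (not (h x))                      ≡⟨ Boolₚ.not-involutive (h x) ⟩
    h x                                  ≡⟨ update-≢ h x≢1 ⟨
    update h ones c x                    ∎

-- Joining two antipodal copies of a network

-- For self-dual `F` the vector `∁ (F zeros)` is `F ones`, so the two new values are the old images
-- exchanged.
join : BooleanNetwork n → BooleanNetwork (suc n)
join F (false ∷ x) = update ((false ∷_) ∘ F) zeros (true ∷ ∁ (F zeros)) x
join F (true  ∷ x) = update ((true ∷_) ∘ F) ones (false ∷ F zeros) x

join-selfDual : (F : BooleanNetwork n) → SelfDual F → SelfDual (join F)
join-selfDual F dual (false ∷ x) with x ≟ zeros
... | yes refl = begin
  join F (true ∷ ∁ zeros)      ≡⟨ update-≡ _ ∁-zeros ⟩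
  false ∷ F zeros              ≡⟨ cong (false ∷_) (∁-involutive (F zeros)) ⟨
  ∁ (true ∷ ∁ (F zeros))       ≡⟨ cong ∁ (update-≡ _ refl) ⟨
  ∁ (join F (false ∷ zeros))   ∎
  where open ≡-Reasoning
... | no x≢0 = begin
  join F (true ∷ ∁ x)      ≡⟨ update-≢ _ (∁x≢ones x≢0) ⟩
  true ∷ F (∁ x)           ≡⟨ cong (true ∷_) (dual x) ⟩
  ∁ (false ∷ F x)          ≡⟨ cong ∁ (update-≢ _ x≢0) ⟨
  ∁ (join F (false ∷ x))   ∎
  where open ≡-Reasoning
join-selfDual F dual (true ∷ x) with x ≟ ones
... | yes refl = begin
  join F (false ∷ ∁ ones)    ≡⟨ update-≡ _ ∁-ones ⟩
  ∁ (false ∷ F zeros)        ≡⟨ cong ∁ (update-≡ _ refl) ⟨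
  ∁ (join F (true ∷ ones))   ∎
  where open ≡-Reasoning
... | no x≢1 = begin
  join F (false ∷ ∁ x)    ≡⟨ update-≢ _ (∁x≢zeros x≢1) ⟩
  false ∷ F (∁ x)         ≡⟨ cong (false ∷_) (dual x) ⟩
  ∁ (true ∷ F x)          ≡⟨ cong ∁ (update-≢ _ x≢1) ⟨
  ∁ (join F (true ∷ x))   ∎
  where open ≡-Reasoning

-- From `true ∷ ∁ (F zeros)` the walk runs through the true half to `ones`, crosses to
-- `false ∷ F zeros` and then runs through the false half.
join-reachable : (F : BooleanNetwork n) → SelfDual F →
                 (∀ x → Reachable F (F zeros) x) →
                 ∀ x → Reachable (join F) (join F zeros) x
join-reachable F dual all (b ∷ x) =
  subst (λ y → Reachable (join F) y (b ∷ x)) (sym (update-≡ _ refl)) (both b)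
  where
  slice₀ : ∀ x → Reachable (join F) (false ∷ F zeros) (false ∷ x)
  slice₀ x = reachable-preserves (Reachable (join F) (false ∷ F zeros) ∘ (false ∷_))
    step reachable-refl (all x)
    where
    step : ∀ y → Reachable (join F) (false ∷ F zeros) (false ∷ y) →
           Reachable (join F) (false ∷ F zeros) (false ∷ F y)
    step y r with y ≟ zeros
    -- After `zeros`, `F` is back at the start of the slice, so the redirected arc is not followed.
    ... | yes refl = reachable-refl
    ... | no  y≢0  = reachable-trans r (1 , update-≢ _ y≢0)

  slice₁ : ∀ x → Reachable (join F) (true ∷ ∁ (F zeros)) (true ∷ x)
  -- Complementation carries the false slice, with its starting point, to the true one.
  slice₁ x = subst (Reachable (join F) _ ∘ (true ∷_)) (∁-involutive x)
    (reachable-∁ (join-selfDual F dual) (slice₀ (∁ x)))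

  both : ∀ b → Reachable (join F) (true ∷ ∁ (F zeros)) (b ∷ x)
  both true  = slice₁ x
  both false = reachable-trans (slice₁ ones) (reachable-trans (1 , update-≡ _ refl) (slice₀ x))

module _ {h : Config (suc n) → Bool} {h₀ h₁ : Config n → Bool} {d₀ d₁ : Bool}
         (h-false : h ∘ (false ∷_) ≗ update h₀ zeros d₀)
         (h-true : h ∘ (true ∷_) ≗ update h₁ ones d₁) where

  -- Redefining `h` at `zeros` overrides `d₀`, so of the exchange only `d₁` in the true half
  -- survives.
  update-false : ∀ c → update h₀ zeros c ≗ update h zeros c ∘ (false ∷_)
  update-false c x = go (x ≟ zeros)
    where
    open ≡-Reasoning
    go : Dec (x ≡ zeros) → update h₀ zeros c x ≡ update h zeros c (false ∷ x)
    go (yes refl) = trans (update-≡ h₀ refl) (sym (update-≡ h refl))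
    go (no  x≢0)  = begin
      update h₀ zeros c x            ≡⟨ update-≢ h₀ x≢0 ⟩
      h₀ x                           ≡⟨ update-≢ h₀ x≢0 ⟨
      update h₀ zeros d₀ x           ≡⟨ h-false x ⟨
      h (false ∷ x)                  ≡⟨ update-≢ h (x≢0 ∘ ∷-injectiveʳ) ⟨
      update h zeros c (false ∷ x)   ∎

  update-true : ∀ c → update h₁ ones d₁ ≗ update h zeros c ∘ (true ∷_)
  update-true c x = sym (trans (update-≢ h (λ ())) (h-true x))

  module _ (_≲_ : Rel Bool 0ℓ) where

    update-along-zero : ∀ c → (∀ x → update h₀ zeros c x ≲ update h₁ ones d₁ x) →
                        Along _≲_ (update h zeros c) zero
    update-along-zero c le = along-zero _≲_ λ x →
      subst₂ _≲_ (update-false c x) (update-true c x) (le x)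

    update-along-suc : ∀ c {i} → Along _≲_ (update h₀ zeros c) i →
                       Along _≲_ (update h₁ ones d₁) i →
                       Along _≲_ (update h zeros c) (suc i)
    update-along-suc c mono₀ mono₁ = along-suc _≲_
      (along-resp-≗ _≲_ (update-false c) mono₀) (along-resp-≗ _≲_ (update-true c) mono₁)

-- In positive dimension `zeros` and `ones` differ, so at `ones` the left side is still `false`;
-- elsewhere the right side is `true`.
update-false≤update-true : ∀ c (x : Config (suc n)) →
  update (λ _ → false) zeros c x Bool.≤ update (λ _ → true) ones false x
update-false≤update-true c x with x ≟ ones
... | yes refl = ≡false⇒≤ (update-≢ _ λ ())
... | no  x≢1  = ≡true⇒≤ (update-≢ _ x≢1)

-- The two sides can differ only at `zeros` and at `ones`, and at both the right side is `h zeros`,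
-- the largest value for `≲`.
update-zeros≲update-ones : (_≲_ : Rel Bool 0ℓ) → (∀ b → b ≲ b) →
  ∀ (h : Config (suc n) → Bool) → (∀ c → c ≲ h zeros) →
  ∀ c x → update h zeros c x ≲ update h ones (h zeros) x
update-zeros≲update-ones _≲_ ≲-refl h ≲max c x with x ≟ zeros | x ≟ ones
... | yes refl | _        =
  subst₂ _≲_ (sym (update-≡ h refl)) (sym (update-≢ h λ ())) (≲max c)
... | no  x≢0  | yes refl =
  subst₂ _≲_ (sym (update-≢ h x≢0)) (sym (update-≡ h refl)) (≲max (h ones))
... | no  x≢0  | no  x≢1  =
  subst₂ _≲_ (sym (update-≢ h x≢0)) (sym (update-≢ h x≢1)) (≲-refl (h x))

join-free : (F : BooleanNetwork (suc n)) → SelfDual F →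
            (∀ j → Free (component F j) zeros) →
            ∀ j → Free (component (join F) j) zeros
join-free F dual free zero = λ where
    -- The first component of `join F` copies the new variable except at the two exchanged points.
    -- It increases in that variable and decreases in all others.
    zero    → inj₁ λ c → update-along-zero f₀ f₁ Bool._≤_ c (update-false≤update-true c)
    (suc i) → inj₂ λ c → update-along-suc f₀ f₁ (flip Bool._≤_) c
      (update-false-decreasing c i) (update-true-decreasing false i)
  where
  f₀ = update-∘ (λ y → lookup y zero) ((false ∷_) ∘ F) zeros (true ∷ ∁ (F zeros))
  f₁ = update-∘ (λ y → lookup y zero) ((true ∷_) ∘ F) ones (false ∷ F zeros)
join-free F dual free (suc j) = λ where
    zero    → Sum.map (zero-direction Bool._≤_ (λ _ → Boolₚ.≤-refl))
                      (zero-direction (flip Bool._≤_) (λ _ → Boolₚ.≤-refl))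
                      -- The value `f zeros` decides the direction in the new variable: `true` gives
                      -- increasing, `false` decreasing.
                      (≤max⊎≥min (f zeros))
    (suc i) → Sum.map (suc-direction Bool._≤_ not-antitone)
                      (suc-direction (flip Bool._≤_) not-antitone)
                      (free j i)
  where
  f = component F j
  f₀ = update-∘ (λ y → lookup y (suc j)) ((false ∷_) ∘ F) zeros (true ∷ ∁ (F zeros))
  f₁ = update-∘ (λ y → lookup y (suc j)) ((true ∷_) ∘ F) ones (false ∷ F zeros)

  f-dual : ∀ x → f (∁ x) ≡ not (f x)
  f-dual x = trans (cong (λ y → lookup y j) (dual x)) (lookup-map j not (F x))

  ≤max⊎≥min : ∀ b → (∀ c → c Bool.≤ b) ⊎ (∀ c → b Bool.≤ c)
  ≤max⊎≥min true  = inj₁ Boolₚ.≤-maximum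
  ≤max⊎≥min false = inj₂ Boolₚ.≤-minimum

  zero-direction : ∀ _≲_ → (∀ b → b ≲ b) → (∀ c → c ≲ f zeros) →
                   FreeAlong _≲_ (component (join F) (suc j)) zeros zero
  zero-direction _≲_ ≲-refl ≲max c = update-along-zero f₀ f₁ _≲_ c
    (update-zeros≲update-ones _≲_ ≲-refl f ≲max c)

  suc-direction : ∀ _≲_ → (∀ {x y} → x ≲ y → not y ≲ not x) → ∀ {i} →
                  FreeAlong _≲_ f zeros i →
                  FreeAlong _≲_ (component (join F) (suc j)) zeros (suc i)
  -- The false half is `f` redefined at `zeros`; the true half is `f` redefined at `ones` as
  -- `f zeros`, which is covered by duality.
  suc-direction _≲_ anti mono c = update-along-suc f₀ f₁ _≲_ c (mono c)
    (freeAlong-ones _≲_ anti f-dual mono (f zeros))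

-- Hamiltonian cycles in every dimension, and the theorem

network : ∀ m → BooleanNetwork (suc m)
-- The induction starts with one variable, since with none `zeros` and `ones` coincide.
network zero    = ∁
network (suc m) = join (network m)

network-selfDual : ∀ m → SelfDual (network m)
network-selfDual zero    x = refl
network-selfDual (suc m)   = join-selfDual (network m) (network-selfDual m)

network-reachable : ∀ m x → Reachable (network m) (network m zeros) x
network-reachable zero    (true  ∷ []) = reachable-refl
network-reachable zero    (false ∷ []) = reachable-step _
network-reachable (suc m) =
  join-reachable (network m) (network-selfDual m) (network-reachable m)

network-free : ∀ m j → Free (component (network m) j) zeros
network-free zero    zero zero = inj₂ λ where
  -- Only the lower point is redefined; the upper one keeps the value `false`.
  c (false ∷ []) refl → ≡false⇒≤ (update-≢ _ λ ())
network-free (suc m) = join-free (network m) (network-selfDual m) (network-free m)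

-- Component `j` is redefined as `lookup c j`, and freeness covers either value, so nothing has to
-- be known about `c`.
redirected-unate : ∀ (F : BooleanNetwork n) a → (∀ j → Free (component F j) a) →
                   ∀ c → UnateNetwork (update F a c)
redirected-unate F a free c j i = Sum.map
  (λ inc → along-resp-≗ Bool._≤_ agree (inc (lookup c j)))
  (λ dec → along-resp-≗ (flip Bool._≤_) agree (dec (lookup c j)))
  (free j i)
  where agree = sym ∘ update-∘ (λ y → lookup y j) F a c

theorem4p3 : (n : ℕ) → 1 ≤ n → (G : Digraph) → G ∈𝒢 n → HamiltonianDigraph n G →
    Σ (BooleanNetwork n) λ g → UnateNetwork g × Γ g ≅ G
theorem4p3 (suc m) _ G G∈𝒢 (f , (x , y , p , _ , visitsAll) , G≅Γf) =
  -- The enumeration of the vertices of `G` is carried over to configurations, so that the orbits of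
  -- both networks are counted by the same number.
  let c , Γf≅Γg = redirect (_∈𝒢_.order G∈𝒢 ↔-∘ ↔-sym (proj₁ G≅Γf))
                    (λ v → vertices⇒reachable p (visitsAll v)) (network-reachable m)
      g = update (network m) zeros c
  in g , redirected-unate (network m) zeros (network-free m) c ,
     ≅-sym {G} {Γ g} (≅-trans {G} {Γ f} {Γ g} G≅Γf Γf≅Γg)
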